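{- (Subject Reduction.) Let $(\mathcal S,\mathcal A,\mathcal R)$ be any Pure Type System. (i) For all contexts $\Gamma,\Delta$: if $\Gamma\ \mathsf{ok}$ and $\Gamma\to\to_{\beta_=}\Delta$, then $\Delta\ \mathsf{ok}$. (ii) For all contexts $\Gamma,\Delta$ and terms $M,N,A$: if $\Gamma\vdash M:A$, $\Gamma\to\to_{\beta_=}\Delta$ and $M\to_{\beta_=}N$, then $\Delta\vdash N:A$.
   Context: Syntax. Fix a type $\mathcal S$ of sorts (used as constants) and a countably infinite type $\mathcal V$ of variables with decidable equality and a fixed enumeration. Raw terms $\Lambda$ (NOT identified up to $\alpha$): $M,N,A,B::= s \mid x \mid \lambda[x:A]M \mid \Pi[x:A]B \mid M\cdot N$ with $s\in\mathcal S$, $x\in\mathcal V$. $\mathrm{fv}(M)$ is the (finite list of) free variables, where $\lambda[x:A]M$ and $\Pi[x:A]M$ bind $x$ in $M$ but not in $A$; $\mathrm{fv}(M)-x$ is $\mathrm{fv}(M)$ with $x$ removed. $\equiv$ is syntactic identity. Substitution (Stoughton). A substitution is a function $\sigma:\mathcal V\to\Lambda$; $\iota$ is the identity; $(\sigma,x:=N)$ maps $x$ to $N$ and any other $y$ to $\sigma y$. For a finite list $xs$ of variables, $X(\sigma,xs)$ is the first variable (in the enumeration) not occurring free in $\sigma y$ for any $y\in xs$. Define $s\bullet\sigma=s$, $x\bullet\sigma=\sigma x$, $(M\cdot N)\bullet\sigma=(M\bullet\sigma)\cdot(N\bullet\sigma)$, and for $Q\in\{\lambda,\Pi\}$, $(Q[x:A]M)\bullet\sigma=Q[y:A\bullet\sigma](M\bullet(\sigma,x:=y))$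 where $y=X(\sigma,\mathrm{fv}(M)-x)$. Write $M[x:=N]$ for $M\bullet(\iota,x:=N)$. $\alpha$-conversion $\sim_\alpha$ is inductively defined by: $s\sim_\alpha s$; $x\sim_\alpha x$; if $M\sim_\alpha M'$ and $N\sim_\alpha N'$ then $M\cdot N\sim_\alpha M'\cdot N'$; for $Q\in\{\lambda,\Pi\}$, if $A\sim_\alpha A'$ and $M[x:=y]\equiv M'[x':=y]$ for some $y\notin\mathrm{fv}(M)-x$, $y\notin\mathrm{fv}(M')-x'$, then $Q[x:A]M\sim_\alpha Q[x':A']M'$. $\beta$. $\to_\beta$ is the contextual closure (under both positions of application, and both the domain and the body of $\lambda$ and $\Pi$) of $(\lambda[x:A]M)\cdot N\triangleright_\beta M[x:=N]$. $\simeq_\beta$ is the least equivalence relation containing $\sim_\alpha$ and $\to_\beta$. $M\to_{\beta_=}N$ means $M\equiv N$ or $M\to_\beta N$. Pure Type System. It is specified by sorts $\mathcal S$, axioms $\mathcal A\subseteq\mathcal S^2$ and rules $\mathcal R\subseteq\mathcal S^3$ (arbitrary relations). Contexts are finite lists of pairs $(x,A)\in\mathcal V\times\Lambda$; $\Gamma,x:A$ extends $\Gamma$ by $(x,A)$; $\mathrm{dom}\,\Gamma$ is the list of its variables. $\Gamma\to\to_{\beta_=}\Delta$ means $\Gamma,\Delta$ have the same length and corresponding entries $(x,A)$, $(y,B)$ satisfy $x\equiv y$ and $A\to_{\beta_=}B$. The judgments $\Gamma\ \mathsf{ok}$ and $\Gamma\vdash M:A$ are mutually inductively defined by: - $[]\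 \mathsf{ok}$; if $\Gamma\ \mathsf{ok}$, $\Gamma\vdash A:s$ and $x\notin\mathrm{dom}\,\Gamma$ then $(\Gamma,x:A)\ \mathsf{ok}$. - (sort) if $\Gamma\ \mathsf{ok}$ and $\mathcal A\,s_1\,s_2$ then $\Gamma\vdash s_1:s_2$. - (var) if $\Gamma\ \mathsf{ok}$ and $(x,A)\in\Gamma$ then $\Gamma\vdash x:A$. - (prod) if $\Gamma\vdash A:s_1$, $\Gamma,y:A\vdash B[x:=y]:s_2$, $\mathcal R\,s_1\,s_2\,s_3$ and $y\notin\mathrm{fv}(B)-x$ then $\Gamma\vdash\Pi[x:A]B:s_3$. - (abs) if $\Gamma\vdash A:s_1$, $\Gamma,z:A\vdash M[x:=z]:B[y:=z]$, $\Gamma,z:A\vdash B[y:=z]:s_2$, $\mathcal R\,s_1\,s_2\,s_3$, $z\notin\mathrm{fv}(M)-x$ and $z\notin\mathrm{fv}(B)-y$ then $\Gamma\vdash\lambda[x:A]M:\Pi[y:A]B$. - (app) if $\Gamma\vdash M:\Pi[x:A]B$ and $\Gamma\vdash N:A$ then $\Gamma\vdash M\cdot N:B[x:=N]$. - (conv) if $\Gamma\vdash M:A$, $\Gamma\vdash B:s$ and $A\simeq_\beta B$ then $\Gamma\vdash M:B$. -}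

module Defs where

open import Level using (Level; _⊔_) renaming (suc to lsuc)
open import Data.Bool using (if_then_else_)
open import Data.Fin using (Fin; toℕ; fromℕ<)
open import Data.Fin.Properties
  using (pigeonhole; ¬∀⟶∃¬-smallest; toℕ-injective; toℕ-inject; toℕ-fromℕ<; <⇒≢)
open import Data.List using (List; []; _∷_; _++_; map; concatMap; filter; length; lookup)
open import Data.List.Relation.Binary.Pointwise using (Pointwise)
open import Data.List.Relation.Unary.Any using (index)
open import Data.List.Relation.Unary.Any.Properties using (lookup-index)
open import Data.List.Membership.Propositional using (_∈_; _∉_)
import Data.List.Membership.DecPropositional as DecMembership
open import Data.Nat using (ℕ; suc; _<_)
open import Data.Nat.Properties using (n<1+n)
open import Data.Product using (∃; _×_; _,_; proj₁)
import Data.Product.Relation.Binary.Pointwise.NonDependent as Product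
open import Function using (_∘_; _⤖_; module Bijection)
open import Relation.Binary using (Rel; DecidableEquality)
open import Relation.Binary.Construct.Closure.Equivalence using (EqClosure)
open import Relation.Binary.Construct.Closure.Reflexive using (ReflClosure)
open import Relation.Binary.Construct.Union using (_∪_)
open import Relation.Binary.PropositionalEquality
  using (_≡_; refl; sym; trans; cong; subst)
open import Relation.Nullary using (¬_; does)
open import Relation.Nullary.Decidable using (¬?)

record Variables : Set₁ where
  field
    V    : Set
    _≟_  : DecidableEquality V
    enum : ℕ ⤖ V

  nth : ℕ → V
  nth = Bijection.to enum

  open DecMembership _≟_ using (_∈?_)

  ¬allIn : (zs : List V) → ¬ (∀ (j : Fin (suc (length zs))) → nth (toℕ j) ∈ zs)
  ¬allIn zs all =
    let i , j , i<j , same = pigeonhole (n<1+n (length zs)) (index ∘ all)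
    in <⇒≢ i<j (toℕ-injective (Bijection.injective enum
         (trans (lookup-index (all i))
           (trans (cong (lookup zs) same) (sym (lookup-index (all j)))))))

  firstFresh : (zs : List V) →
               ∃ λ n → nth n ∉ zs × (∀ m → m < n → nth m ∈ zs)
  firstFresh zs =
    let i , i∉ , below = ¬∀⟶∃¬-smallest (suc (length zs))
          (λ j → nth (toℕ j) ∈ zs) (λ j → nth (toℕ j) ∈? zs) (¬allIn zs)
    in toℕ i , i∉ , λ m m<i →
         subst (λ k → nth k ∈ zs)
               (trans (toℕ-inject (fromℕ< m<i)) (toℕ-fromℕ< m<i))
               (below (fromℕ< m<i))

record PTS (s a r : Level) : Set (lsuc (s ⊔ a ⊔ r)) where
  field
    Sort : Set s
    𝒜    : Sort → Sort → Set a
    ℛ    : Sort → Sort → Sort → Set r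

data Binder : Set where
  lam pi : Binder

module Terms (𝒱 : Variables) {s : Level} (𝒮 : Set s) where

  open Variables 𝒱

  infixl 9 _-_
  infix 8 _∙_ _[_≔_]
  infixl 7 _·_
  infix 6 ƛ[_∶_]_ Π[_∶_]_
  infix 4 _∼α_ _▷β_ _⟶β_ _≃β_ _⟶β=_

  data Λ : Set s where
    sort : 𝒮 → Λ
    var  : V → Λ
    bind : Binder → V → Λ → Λ → Λ
    _·_  : Λ → Λ → Λ

  pattern ƛ[_∶_]_ x A M = bind lam x A M
  pattern Π[_∶_]_ x A B = bind pi x A B

  _-_ : List V → V → List V
  xs - x = filter (λ y → ¬? (y ≟ x)) xs

  fv : Λ → List V
  fv (sort _)       = []
  fv (var x)        = x ∷ []
  fv (bind _ x A M) = fv A ++ (fv M - x)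
  fv (M · N)        = fv M ++ fv N

  Substitution : Set s
  Substitution = V → Λ

  ι : Substitution
  ι = var

  _,_≔_ : Substitution → V → Λ → Substitution
  (σ , x ≔ N) y = if does (y ≟ x) then N else σ y

  X : Substitution → List V → V
  X σ xs = nth (proj₁ (firstFresh (concatMap (fv ∘ σ) xs)))

  _∙_ : Λ → Substitution → Λ
  sort c       ∙ σ = sort c
  var x        ∙ σ = σ x
  bind Q x A M ∙ σ =
    let y = X σ (fv M - x)
    in bind Q y (A ∙ σ) (M ∙ (σ , x ≔ var y))
  (M · N)      ∙ σ = (M ∙ σ) · (N ∙ σ)

  _[_≔_] : Λ → V → Λ → Λ
  M [ x ≔ N ] = M ∙ (ι , x ≔ N)

  data _∼α_ : Rel Λ s where
    sort : ∀ {c} → sort c ∼α sort c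
    var  : ∀ {x} → var x ∼α var x
    app  : ∀ {M M′ N N′} → M ∼α M′ → N ∼α N′ → M · N ∼α M′ · N′
    bind : ∀ {Q x x′ A A′ M M′} (y : V) →
           A ∼α A′ →
           y ∉ fv M - x → y ∉ fv M′ - x′ →
           M [ x ≔ var y ] ≡ M′ [ x′ ≔ var y ] →
           bind Q x A M ∼α bind Q x′ A′ M′

  data _▷β_ : Rel Λ s where
    β : ∀ {x A M N} → (ƛ[ x ∶ A ] M) · N ▷β M [ x ≔ N ]

  data _⟶β_ : Rel Λ s where
    redex : ∀ {M N} → M ▷β N → M ⟶β N
    appˡ  : ∀ {M M′ N} → M ⟶β M′ → M · N ⟶β M′ · N
    appʳ  : ∀ {M N N′} → N ⟶β N′ → M · N ⟶β M · N′
    dom   : ∀ {Q x A A′ M} → A ⟶β A′ → bind Q x A M ⟶β bind Q x A′ M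
    body  : ∀ {Q x A M M′} → M ⟶β M′ → bind Q x A M ⟶β bind Q x A M′

  _≃β_ : Rel Λ s
  _≃β_ = EqClosure (_∼α_ ∪ _⟶β_)

  _⟶β=_ : Rel Λ s
  _⟶β=_ = ReflClosure _⟶β_

module Typing (𝒱 : Variables) {s a r : Level} (𝒫 : PTS s a r) where

  open Variables 𝒱 using (V)
  open PTS 𝒫
  open Terms 𝒱 Sort public

  -- The most recent declaration is at the head.
  Context : Set s
  Context = List (V × Λ)

  pattern _▸_∶_ Γ x A = (x , A) ∷ Γ

  domain : Context → List V
  domain = map proj₁

  infixl 5 _▸_∶_
  infix 4 _⟶⟶β=_ _ok _⊢_∶_

  _⟶⟶β=_ : Rel Context s
  _⟶⟶β=_ = Pointwise (Product.Pointwise _≡_ _⟶β=_)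

  data _ok : Context → Set (s ⊔ a ⊔ r)
  data _⊢_∶_ : Context → Λ → Λ → Set (s ⊔ a ⊔ r)

  data _ok where
    []  : [] ok
    ext : ∀ {Γ x A c} →
          Γ ok → Γ ⊢ A ∶ sort c → x ∉ domain Γ →
          Γ ▸ x ∶ A ok

  data _⊢_∶_ where
    sort : ∀ {Γ s₁ s₂} →
           Γ ok → 𝒜 s₁ s₂ →
           Γ ⊢ sort s₁ ∶ sort s₂
    var  : ∀ {Γ x A} →
           Γ ok → (x , A) ∈ Γ →
           Γ ⊢ var x ∶ A
    prod : ∀ {Γ x A B s₁ s₂ s₃} (y : V) →
           Γ ⊢ A ∶ sort s₁ →
           Γ ▸ y ∶ A ⊢ B [ x ≔ var y ] ∶ sort s₂ →
           ℛ s₁ s₂ s₃ →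
           y ∉ fv B - x →
           Γ ⊢ Π[ x ∶ A ] B ∶ sort s₃
    abs  : ∀ {Γ x y A B M s₁ s₂ s₃} (z : V) →
           Γ ⊢ A ∶ sort s₁ →
           Γ ▸ z ∶ A ⊢ M [ x ≔ var z ] ∶ B [ y ≔ var z ] →
           Γ ▸ z ∶ A ⊢ B [ y ≔ var z ] ∶ sort s₂ →
           ℛ s₁ s₂ s₃ →
           z ∉ fv M - x → z ∉ fv B - y →
           Γ ⊢ ƛ[ x ∶ A ] M ∶ Π[ y ∶ A ] B
    app  : ∀ {Γ x A B M N} →
           Γ ⊢ M ∶ Π[ x ∶ A ] B → Γ ⊢ N ∶ A →
           Γ ⊢ M · N ∶ B [ x ≔ N ]
    conv : ∀ {Γ M A B c} →
           Γ ⊢ M ∶ A → Γ ⊢ B ∶ sort c → A ≃β B →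
           Γ ⊢ M ∶ B

{-# OPTIONS --safe #-}

-- Substitution composes up to syntactic identity and depends only on the values
-- at the free variables, so M ↦ M ∙ ι computes canonical representatives of
-- α-classes. Parallel reduction modulo α has the diamond property, which yields
-- confluence and the injectivity of Π up to ≃β.
--
-- Typing is first shown to be stable under substitutions with canonical values.
-- Such statements reach M ∙ ι : A ∙ ι rather than M : A, and correctness of types
-- is obtained in this form: if Γ ⊢ M : A and A is not a sort, then A ∙ ι is typed
-- by a sort. This suffices to show, by induction on derivations, that a term
-- related to M by α or by parallel reduction has type A ∙ ι; invariance under α
-- then gives back the type A itself.
module Submission where

open import Level using (Level; _⊔_)
open import Data.List using (List; []; _∷_; _++_; concatMap)
open import Data.List.Membership.Propositional using (_∈_; _∉_; find; lose)
open import Data.List.Membership.Propositional.Properties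
  using (∈-++⁺ˡ; ∈-++⁺ʳ; ∈-++⁻; ∈-filter⁺; ∈-filter⁻; ∈-concatMap⁺; ∈-concatMap⁻; ∈-map⁺)
open import Data.List.Relation.Binary.Pointwise using ([]; _∷_)
open import Data.List.Relation.Binary.Subset.Propositional using (_⊆_)
open import Data.List.Relation.Unary.Any using (here; there)
open import Data.Nat using (ℕ; _<_)
open import Data.Nat.Properties using (<-cmp)
open import Data.Product using (∃; _×_; _,_; proj₁; proj₂)
open import Data.Sum using (_⊎_; inj₁; inj₂; [_,_]′)
open import Function using (_∘_; id)
open import Relation.Binary using (Rel; IsEquivalence; tri<; tri≈; tri>)
import Relation.Binary.Construct.Closure.Equivalence as Eq
import Relation.Binary.Construct.Closure.Reflexive as Refl
open import Relation.Binary.Construct.Closure.ReflexiveTransitive using (Star; ε; _◅_; _◅◅_)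
open import Relation.Binary.Construct.Union using (_∪_)
open import Relation.Binary.PropositionalEquality
  using (_≡_; _≢_; refl; sym; trans; cong; cong₂; subst; subst₂)
open import Relation.Binary.Rewriting using (Confluent)
open import Relation.Nullary using (yes; no; contradiction)
open import Relation.Nullary.Decidable using (¬?)
open import Defs using (Variables; PTS; Binder; module Terms; module Typing)

module TermProperties (𝒱 : Variables) {s : Level} (𝒮 : Set s) where

  open Variables 𝒱
  open Terms 𝒱 𝒮

  -- Fresh names and their dependence on the names to avoid.

  ∈--⁺ : ∀ {z x xs} → z ∈ xs → z ≢ x → z ∈ xs - x
  ∈--⁺ {x = x} = ∈-filter⁺ (λ y → ¬? (y ≟ x))

  ∈--⁻ : ∀ {z x} xs → z ∈ xs - x → z ∈ xs × z ≢ x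
  ∈--⁻ {x = x} xs = ∈-filter⁻ (λ y → ¬? (y ≟ x)) {xs = xs}

  fresh : List V → V
  fresh zs = nth (proj₁ (firstFresh zs))

  fresh-∉ : ∀ zs → fresh zs ∉ zs
  fresh-∉ zs = proj₁ (proj₂ (firstFresh zs))

  FirstFresh : List V → ℕ → Set
  FirstFresh zs n = nth n ∉ zs × (∀ m → m < n → nth m ∈ zs)

  FirstFresh-unique : ∀ {zs zs′ n m} → zs ⊆ zs′ → zs′ ⊆ zs →
                      FirstFresh zs n → FirstFresh zs′ m → n ≡ m
  FirstFresh-unique {n = n} {m} ⊆₁ ⊆₂ (n∉ , <n) (m∉ , <m) with <-cmp n m
  ... | tri< n<m _ _ = contradiction (⊆₂ (<m n n<m)) n∉
  ... | tri≈ _ n≡m _ = n≡m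
  ... | tri> _ _ m<n = contradiction (⊆₁ (<n m m<n)) m∉

  -- The first name outside a list is determined by the set of its members. This makes bound names
  -- chosen by different substitutions syntactically equal.
  fresh-cong : ∀ {zs zs′} → zs ⊆ zs′ → zs′ ⊆ zs → fresh zs ≡ fresh zs′
  fresh-cong {zs} {zs′} ⊆₁ ⊆₂ = cong nth
    (FirstFresh-unique ⊆₁ ⊆₂ (proj₂ (firstFresh zs)) (proj₂ (firstFresh zs′)))

  -- `X σ xs` is the first name outside this set; at `xs = fv M`, `fv-∙⁻` and `fv-∙⁺` identify it
  -- with the free variables of `M ∙ σ`.
  record Image (σ : Substitution) (xs : List V) (z : V) : Set where
    constructor image
    field
      {source}  : V
      source∈   : source ∈ xs
      ∈fvSource : z ∈ fv (σ source)

  X-fresh : ∀ σ {xs z} → z ∈ xs → X σ xs ∉ fv (σ z)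
  X-fresh σ {xs} z∈ w∈ =
    fresh-∉ (concatMap (fv ∘ σ) xs) (∈-concatMap⁺ (fv ∘ σ) (lose z∈ w∈))

  X-cong : ∀ σ τ {xs ys} →
           (∀ {z} → Image σ xs z → Image τ ys z) →
           (∀ {z} → Image τ ys z → Image σ xs z) →
           X σ xs ≡ X τ ys
  X-cong σ τ {xs} {ys} f g = fresh-cong
    (λ z∈ → let _ , y∈ , z∈y = find (∈-concatMap⁻ (fv ∘ σ) {xs = xs} z∈)
                image y∈ z∈y = f (image y∈ z∈y)
            in ∈-concatMap⁺ (fv ∘ τ) (lose y∈ z∈y))
    (λ z∈ → let _ , y∈ , z∈y = find (∈-concatMap⁻ (fv ∘ τ) {xs = ys} z∈)
                image y∈ z∈y = g (image y∈ z∈y)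
            in ∈-concatMap⁺ (fv ∘ σ) (lose y∈ z∈y))

  -- Updates, capture avoidance and free variables of substitution instances.

  upd-elim : ∀ {p} (P : Λ → Set p) σ {x N} z →
             (z ≡ x → P N) → (z ≢ x → P (σ z)) → P ((σ , x ≔ N) z)
  upd-elim P σ {x} z eq neq with z ≟ x
  ... | yes z≡x = eq z≡x
  ... | no  z≢x = neq z≢x

  upd-≡ : ∀ σ {x N} → (σ , x ≔ N) x ≡ N
  upd-≡ σ {N = N} = upd-elim (_≡ N) σ _ (λ _ → refl) (λ x≢x → contradiction refl x≢x)

  upd-≢ : ∀ σ {x N z} → z ≢ x → (σ , x ≔ N) z ≡ σ z
  upd-≢ σ {z = z} z≢x =
    upd-elim (_≡ σ z) σ z (λ z≡x → contradiction z≡x z≢x) (λ _ → refl)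

  _⨟_ : Substitution → Substitution → Substitution
  (σ ⨟ τ) z = σ z ∙ τ

  -- The condition for `w` to replace the bound `x` without capture. Leaving `w` arbitrary also
  -- covers names chosen for another term or substitution, as in parallel reduction.
  record Fresh (σ : Substitution) (x : V) (M : Λ) (w : V) : Set where
    constructor avoid
    field
      avoids : ∀ {z} → z ∈ fv M - x → w ∉ fv (σ z)
  open Fresh

  ι-Fresh : ∀ {x M w} → w ∉ fv M - x → Fresh ι x M w
  ι-Fresh w∉ = avoid λ { z∈ (here refl) → w∉ z∈ }

  X-Fresh : ∀ {σ x M} → Fresh σ x M (X σ (fv M - x))
  X-Fresh {σ} = avoid (X-fresh σ)

  Image-body : ∀ {σ x w} M {z} → Image (σ , x ≔ var w) (fv M) z → z ≢ w →
               Image σ (fv M - x) z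
  Image-body {σ} {x} {w} M {z} (image {y} y∈ z∈) z≢w =
    image (∈--⁺ y∈ y≢x) (subst (λ N → z ∈ fv N) (upd-≢ σ y≢x) z∈)
    where
    y≢x : y ≢ x
    y≢x refl with subst (λ N → z ∈ fv N) (upd-≡ σ) z∈
    ... | here z≡w = z≢w z≡w

  body-Image : ∀ {σ x N} M {z} → Image σ (fv M - x) z → Image (σ , x ≔ N) (fv M) z
  body-Image {σ} M {z} (image y∈ z∈) =
    let y∈M , y≢x = ∈--⁻ (fv M) y∈
    in image y∈M (subst (λ N → z ∈ fv N) (sym (upd-≢ σ y≢x)) z∈)

  mutual
    fv-∙⁻ : ∀ M {σ z} → z ∈ fv (M ∙ σ) → Image σ (fv M) z
    fv-∙⁻ (var x) z∈ = image (here refl) z∈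
    fv-∙⁻ (bind Q x A M) {σ} z∈ =
      [ (λ z∈A → let image y∈ z∈y = fv-∙⁻ A z∈A in image (∈-++⁺ˡ y∈) z∈y)
      , (λ z∈M → let image y∈ z∈y = fv-body⁻ M z∈M in image (∈-++⁺ʳ (fv A) y∈) z∈y)
      ]′ (∈-++⁻ (fv (A ∙ σ)) z∈)
    fv-∙⁻ (M · N) {σ} z∈ =
      [ (λ z∈M → let image y∈ z∈y = fv-∙⁻ M z∈M in image (∈-++⁺ˡ y∈) z∈y)
      , (λ z∈N → let image y∈ z∈y = fv-∙⁻ N z∈N in image (∈-++⁺ʳ (fv M) y∈) z∈y)
      ]′ (∈-++⁻ (fv (M ∙ σ)) z∈)

    fv-body⁻ : ∀ M {σ x w z} → z ∈ fv (M ∙ (σ , x ≔ var w)) - w → Image σ (fv M - x) z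
    fv-body⁻ M {σ} {x} {w} z∈ =
      let z∈M , z≢w = ∈--⁻ (fv (M ∙ (σ , x ≔ var w))) z∈
      in Image-body M (fv-∙⁻ M z∈M) z≢w

  mutual
    fv-∙⁺ : ∀ M {σ z} → Image σ (fv M) z → z ∈ fv (M ∙ σ)
    fv-∙⁺ (var x) (image (here refl) z∈) = z∈
    fv-∙⁺ (bind Q x A M) {σ} (image y∈ z∈) =
      [ (λ y∈A → ∈-++⁺ˡ (fv-∙⁺ A (image y∈A z∈)))
      , (λ y∈M → ∈-++⁺ʳ (fv (A ∙ σ)) (fv-body⁺ M X-Fresh (image y∈M z∈)))
      ]′ (∈-++⁻ (fv A) y∈)
    fv-∙⁺ (M · N) {σ} (image y∈ z∈) =
      [ (λ y∈M → ∈-++⁺ˡ (fv-∙⁺ M (image y∈M z∈)))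
      , (λ y∈N → ∈-++⁺ʳ (fv (M ∙ σ)) (fv-∙⁺ N (image y∈N z∈)))
      ]′ (∈-++⁻ (fv M) y∈)

    fv-body⁺ : ∀ M {σ x w z} → Fresh σ x M w → Image σ (fv M - x) z →
               z ∈ fv (M ∙ (σ , x ≔ var w)) - w
    fv-body⁺ M w# im@(image y∈ z∈) =
      ∈--⁺ (fv-∙⁺ M (body-Image M im)) (λ { refl → avoids w# y∈ z∈ })

  Image-⨟⁺ : ∀ {σ τ xs u z} → Image σ xs u → z ∈ fv (τ u) → Image (σ ⨟ τ) xs z
  Image-⨟⁺ {σ} (image {y} y∈ u∈) z∈ = image y∈ (fv-∙⁺ (σ y) (image u∈ z∈))

  Image-⨟⁻ : ∀ {σ τ xs z} → Image (σ ⨟ τ) xs z → ∃ λ u → Image σ xs u × z ∈ fv (τ u)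
  Image-⨟⁻ {σ} (image {y} y∈ z∈) =
    let image u∈ z∈u = fv-∙⁻ (σ y) z∈ in _ , image y∈ u∈ , z∈u

  -- Extensionality and composition of substitutions.

  bind-cong : ∀ {Q x x′ A A′ M M′} → x ≡ x′ → A ≡ A′ → M ≡ M′ →
              _≡_ {A = Λ} (bind Q x A M) (bind Q x′ A′ M′)
  bind-cong refl refl refl = refl

  ∙-agree : ∀ M {σ τ} → (∀ {z} → z ∈ fv M → σ z ≡ τ z) → M ∙ σ ≡ M ∙ τ
  ∙-agree (sort c) eq = refl
  ∙-agree (var x) eq = eq (here refl)
  ∙-agree (bind Q x A M) {σ} {τ} eq = bind-cong w≡w′ (∙-agree A (eq ∘ ∈-++⁺ˡ)) (∙-agree M ext)
    where
    eqM : ∀ {z} → z ∈ fv M - x → σ z ≡ τ z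
    eqM = eq ∘ ∈-++⁺ʳ (fv A)
    w≡w′ : X σ (fv M - x) ≡ X τ (fv M - x)
    w≡w′ = X-cong σ τ (λ (image y∈ z∈) → image y∈ (subst (λ N → _ ∈ fv N) (eqM y∈) z∈))
                      (λ (image y∈ z∈) → image y∈ (subst (λ N → _ ∈ fv N) (sym (eqM y∈)) z∈))
    ext : ∀ {z} → z ∈ fv M →
          (σ , x ≔ var (X σ (fv M - x))) z ≡ (τ , x ≔ var (X τ (fv M - x))) z
    ext {z} z∈ = upd-elim (_≡ (τ , x ≔ _) z) σ z
      (λ { refl → trans (cong var w≡w′) (sym (upd-≡ τ)) })
      (λ z≢x → trans (eqM (∈--⁺ z∈ z≢x)) (sym (upd-≢ τ z≢x)))
  ∙-agree (M · N) eq =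
    cong₂ _·_ (∙-agree M (eq ∘ ∈-++⁺ˡ)) (∙-agree N (eq ∘ ∈-++⁺ʳ (fv M)))

  ∙-upd-agree : ∀ M {σ τ x N} → (∀ {z} → z ∈ fv M - x → σ z ≡ τ z) →
                M ∙ (σ , x ≔ N) ≡ M ∙ (τ , x ≔ N)
  ∙-upd-agree M {σ} {τ} {x} {N} eq = ∙-agree M λ {z} z∈ → upd-elim (_≡ (τ , x ≔ N) z) σ z
    (λ { refl → sym (upd-≡ τ) })
    (λ z≢x → trans (eq (∈--⁺ z∈ z≢x)) (sym (upd-≢ τ z≢x)))

  ∙-upd-∉ : ∀ M {σ x N} → x ∉ fv M → M ∙ (σ , x ≔ N) ≡ M ∙ σ
  ∙-upd-∉ M {σ} x∉ = ∙-agree M λ z∈ → upd-≢ σ λ { refl → x∉ z∈ }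

  -- Substitution picks its bound names from the set of free names it has to
  -- avoid, so composing substitutions is an identity and not just an
  -- α-conversion; only the freshness of the intermediate bound name matters.
  mutual
    ∙-∙ : ∀ M {σ τ} → (M ∙ σ) ∙ τ ≡ M ∙ (σ ⨟ τ)
    ∙-∙ (sort c) = refl
    ∙-∙ (var x) = refl
    ∙-∙ (bind Q x A M) {σ} = bind-∙ A M X-Fresh
    ∙-∙ (M · N) = cong₂ _·_ (∙-∙ M) (∙-∙ N)

    bind-∙ : ∀ {Q} A M {x w σ τ} → Fresh σ x M w →
             (bind Q w (A ∙ σ) (M ∙ (σ , x ≔ var w))) ∙ τ ≡ (bind Q x A M) ∙ (σ ⨟ τ)
    bind-∙ A M {x} {w} {σ} {τ} w# = bind-cong names (∙-∙ A)
      (trans (∙-open M w#) (cong (λ v → M ∙ ((σ ⨟ τ) , x ≔ var v)) names))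
      where
      names : X τ (fv (M ∙ (σ , x ≔ var w)) - w) ≡ X (σ ⨟ τ) (fv M - x)
      names = X-cong τ (σ ⨟ τ)
        (λ (image u∈ z∈) → Image-⨟⁺ (fv-body⁻ M u∈) z∈)
        (λ im → let u , im-u , z∈ = Image-⨟⁻ im in image (fv-body⁺ M w# im-u) z∈)

    ∙-open : ∀ M {σ τ x w N} → Fresh σ x M w →
             (M ∙ (σ , x ≔ var w)) ∙ (τ , w ≔ N) ≡ M ∙ ((σ ⨟ τ) , x ≔ N)
    ∙-open M {σ} {τ} {x} {w} {N} w# = trans (∙-∙ M) (∙-agree M λ {z} z∈ →
      upd-elim (λ L → L ∙ (τ , w ≔ N) ≡ ((σ ⨟ τ) , x ≔ N) z) σ z
        (λ { refl → trans (upd-≡ τ) (sym (upd-≡ (σ ⨟ τ))) })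
        (λ z≢x → trans (∙-upd-∉ (σ z) (avoids w# (∈--⁺ z∈ z≢x))) (sym (upd-≢ (σ ⨟ τ) z≢x))))

  rename-open : ∀ M {τ x w N} → w ∉ fv M - x → (M [ x ≔ var w ]) ∙ (τ , w ≔ N) ≡ M ∙ (τ , x ≔ N)
  rename-open M w∉ = ∙-open M (ι-Fresh w∉)

module ParallelReduction (𝒱 : Variables) {s : Level} (𝒮 : Set s) where

  open Variables 𝒱
  open Terms 𝒱 𝒮
  open TermProperties 𝒱 𝒮
  open Fresh

  -- Canonical forms and α-conversion.

  subst-∙ : ∀ M {σ x N} → (M [ x ≔ N ]) ∙ σ ≡ M ∙ (σ , x ≔ (N ∙ σ))
  subst-∙ M {σ} {x} {N} = trans (∙-∙ M) (∙-agree M λ {z} _ →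
    upd-elim (λ L → L ∙ σ ≡ (σ , x ≔ (N ∙ σ)) z) ι z
      (λ { refl → sym (upd-≡ σ) })
      (λ z≢x → sym (upd-≢ σ z≢x)))

  infix 4 _≈_ _⇛_ _⇛*_

  -- Since _∙ ι renames all bound names canonically, this is α-conversion.
  record _≈_ (M N : Λ) : Set s where
    constructor ι-≡
    field
      ι≡ : M ∙ ι ≡ N ∙ ι
  open _≈_

  ≈-refl : ∀ {M} → M ≈ M
  ≈-refl = ι-≡ refl

  ≈-sym : ∀ {M N} → M ≈ N → N ≈ M
  ≈-sym (ι-≡ eq) = ι-≡ (sym eq)

  ≈-trans : ∀ {M N P} → M ≈ N → N ≈ P → M ≈ P
  ≈-trans (ι-≡ eq) (ι-≡ eq′) = ι-≡ (trans eq eq′)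

  ≡⇒≈ : ∀ {M N} → M ≡ N → M ≈ N
  ≡⇒≈ refl = ≈-refl

  ∙ι-≈ : ∀ M → M ∙ ι ≈ M
  ∙ι-≈ M = ι-≡ (∙-∙ M)

  -- `M ∙ σ` is `(M ∙ ι) ∙ σ` by composition, so substitution sees only the canonical
  -- representative.
  ≈⇒∙≡ : ∀ {M N} → M ≈ N → ∀ σ → M ∙ σ ≡ N ∙ σ
  ≈⇒∙≡ {M} {N} (ι-≡ eq) σ = trans (sym (∙-∙ M)) (trans (cong (_∙ σ) eq) (∙-∙ N))

  ∙-≈ : ∀ M {σ τ} → (∀ z → σ z ≈ τ z) → M ∙ σ ≈ M ∙ τ
  ∙-≈ M σ≈τ = ι-≡ (trans (∙-∙ M) (trans (∙-agree M λ _ → ι≡ (σ≈τ _)) (sym (∙-∙ M))))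

  fv-≈ : ∀ {M N} → M ≈ N → fv M ⊆ fv N
  fv-≈ {M} {N} (ι-≡ eq) {z} z∈
    with fv-∙⁻ N (subst (λ L → z ∈ fv L) eq (fv-∙⁺ M (image z∈ (here refl))))
  ... | image y∈ (here refl) = y∈

  ·-≈ : ∀ {M M′ N N′} → M ≈ M′ → N ≈ N′ → M · N ≈ M′ · N′
  ·-≈ (ι-≡ eq) (ι-≡ eq′) = ι-≡ (cong₂ _·_ eq eq′)

  -- By `bind-∙` with `τ = ι`: composition forgets the intermediate name `w`, so all fresh names
  -- agree up to α.
  bind-∙-≈ : ∀ {Q} A M {x w σ} → Fresh σ x M w →
             bind Q w (A ∙ σ) (M ∙ (σ , x ≔ var w)) ≈ (bind Q x A M) ∙ σ
  bind-∙-≈ {Q} A M {x} w# = ι-≡ (trans (bind-∙ A M w#) (sym (∙-∙ (bind Q x A M))))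

  bind-rename : ∀ {Q} A M {x w} → w ∉ fv M - x →
                bind Q w (A ∙ ι) (M [ x ≔ var w ]) ≈ bind Q x A M
  bind-rename A M w∉ = ≈-trans (bind-∙-≈ A M (ι-Fresh w∉)) (∙ι-≈ _)

  bind-≈ : ∀ {Q} y {x x′ A A′} M M′ → A ≈ A′ →
           y ∉ fv M - x → y ∉ fv M′ - x′ → M [ x ≔ var y ] ≡ M′ [ x′ ≔ var y ] →
           bind Q x A M ≈ bind Q x′ A′ M′
  bind-≈ y {A = A} {A′} M M′ (ι-≡ A≈) y∉ y∉′ eq =
    ≈-trans (≈-sym (bind-rename A M y∉))
      (≈-trans (≡⇒≈ (bind-cong refl A≈ eq)) (bind-rename A′ M′ y∉′))

  bind-congʳ-≈ : ∀ {Q x A A′ M M′} → A ≈ A′ → M ≈ M′ → bind Q x A M ≈ bind Q x A′ M′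
  bind-congʳ-≈ {x = x} {M = M} {M′} A≈ M≈ =
    bind-≈ y M M′ A≈ (y∉ ∘ ∈-++⁺ˡ) (y∉ ∘ ∈-++⁺ʳ (fv M - x)) (≈⇒∙≡ M≈ _)
    where
    y = fresh ((fv M - x) ++ (fv M′ - x))
    y∉ = fresh-∉ ((fv M - x) ++ (fv M′ - x))

  bind-injective : ∀ {Q Q′ x x′ A A′ M M′} → _≡_ {A = Λ} (bind Q x A M) (bind Q′ x′ A′ M′) →
                   Q ≡ Q′ × x ≡ x′ × A ≡ A′ × M ≡ M′
  bind-injective refl = refl , refl , refl , refl

  data Sort≈ (c : 𝒮) : Λ → Set s where
    sort≈ : Sort≈ c (sort c)

  data Var≈ (x : V) : Λ → Set s where
    var≈ : Var≈ x (var x)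

  data App≈ (M N : Λ) : Λ → Set s where
    app≈ : ∀ {M′ N′} → M ≈ M′ → N ≈ N′ → App≈ M N (M′ · N′)

  data Bind≈ (Q : Binder) (x : V) (A M : Λ) : Λ → Set s where
    bind≈ : ∀ {x′ A′ M′} → A ≈ A′ → (∀ σ P → M ∙ (σ , x ≔ P) ≡ M′ ∙ (σ , x′ ≔ P)) →
            Bind≈ Q x A M (bind Q x′ A′ M′)

  sort-≈⁻ : ∀ {c} N → sort c ≈ N → Sort≈ c N
  sort-≈⁻ (sort _) (ι-≡ refl) = sort≈

  var-≈⁻ : ∀ {x} N → var x ≈ N → Var≈ x N
  var-≈⁻ (var _) (ι-≡ refl) = var≈

  ·-injective : ∀ {M M′ N N′} → M · N ≡ M′ · N′ → M ≡ M′ × N ≡ N′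
  ·-injective refl = refl , refl

  app-≈⁻ : ∀ {M N} P → M · N ≈ P → App≈ M N P
  app-≈⁻ (_ · _) (ι-≡ eq) = let M≡ , N≡ = ·-injective eq in app≈ (ι-≡ M≡) (ι-≡ N≡)

  bind-≈⁻ : ∀ {Q x A M} N → bind Q x A M ≈ N → Bind≈ Q x A M N
  bind-≈⁻ {Q} {x} {A} {M} (bind Q′ x′ A′ M′) (ι-≡ eq) with bind-injective eq
  -- The canonical forms share bound name and body, and instantiating that name undoes the renaming
  -- on each side.
  ... | refl , w≡w′ , A≡ , M≡ = bind≈ (ι-≡ A≡) λ σ P →
    trans (sym (rename-open M (X-fresh-ι M)))
      (trans (cong₂ (λ L v → L ∙ (σ , v ≔ P)) M≡ w≡w′) (rename-open M′ (X-fresh-ι M′)))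
    where
    X-fresh-ι : ∀ L {y} → X ι (fv L - y) ∉ fv L - y
    X-fresh-ι L w∈ = X-fresh ι w∈ (here refl)

  ∼α⇒≈ : ∀ {M N} → M ∼α N → M ≈ N
  ∼α⇒≈ sort = ≈-refl
  ∼α⇒≈ var = ≈-refl
  ∼α⇒≈ (app M∼ N∼) = ·-≈ (∼α⇒≈ M∼) (∼α⇒≈ N∼)
  ∼α⇒≈ (bind {M = M} {M′} y A∼ y∉ y∉′ eq) = bind-≈ y M M′ (∼α⇒≈ A∼) y∉ y∉′ eq

  ≈⇒∼α : ∀ M {N} → M ≈ N → M ∼α N
  ≈⇒∼α (sort c) {N} e with sort-≈⁻ N e
  ... | sort≈ = sort
  ≈⇒∼α (var x) {N} e with var-≈⁻ N e
  ... | var≈ = var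
  ≈⇒∼α (M · N) {P} e with app-≈⁻ P e
  ... | app≈ eM eN = app (≈⇒∼α M eM) (≈⇒∼α N eN)
  ≈⇒∼α (bind Q x A M) {P} e with bind-≈⁻ P e
  ... | bind≈ {x′} {M′ = M′} eA eM =
    bind y (≈⇒∼α A eA) (y∉ ∘ ∈-++⁺ˡ) (y∉ ∘ ∈-++⁺ʳ (fv M - x)) (eM ι (var y))
    where
    y = fresh ((fv M - x) ++ (fv M′ - x′))
    y∉ = fresh-∉ ((fv M - x) ++ (fv M′ - x′))

  -- Opening with a name other than `z` neither creates nor removes free occurrences of `z` outside
  -- the binder, so the inclusion for opened bodies transfers.
  fv-open-⊆ : ∀ {x x′} M M′ → (∀ u → fv (M′ [ x′ ≔ var u ]) ⊆ fv (M [ x ≔ var u ])) →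
              fv M′ - x′ ⊆ fv M - x
  fv-open-⊆ M M′ ⊆M {z} z∈
    with image y∈ (here refl) ← Image-body M
           (fv-∙⁻ M (⊆M (fresh (z ∷ [])) (fv-∙⁺ M′ (body-Image M′ (image z∈ (here refl))))))
           (λ z≡ → fresh-∉ (z ∷ []) (here (sym z≡)))
    = y∈

  -- Such an occurrence would transfer to `fv M - x`, where `x` is removed. Hence `x` is a
  -- legitimate name for opening `M′`.
  open-≡⇒bound-∉ : ∀ {x x′} M M′ → (∀ σ P → M ∙ (σ , x ≔ P) ≡ M′ ∙ (σ , x′ ≔ P)) →
                   x ∉ fv M′ - x′
  open-≡⇒bound-∉ M M′ eq x∈ = proj₂ (∈--⁻ (fv M) (fv-open-⊆ M M′
    (λ u {z} → subst (λ L → z ∈ fv L) (sym (eq ι (var u)))) x∈)) refl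

  -- Parallel reduction and its closure under α and substitution.

  -- Absorbing α-conversion into the reduct avoids renaming in the premises, so
  -- that reduction is structural in the reduced term.
  data _⇛_ : Rel Λ s where
    ⇛-sort : ∀ {c} → sort c ⇛ sort c
    ⇛-var  : ∀ {x} → var x ⇛ var x
    ⇛-app  : ∀ {M M′ N N′} → M ⇛ M′ → N ⇛ N′ → M · N ⇛ M′ · N′
    ⇛-bind : ∀ {Q x A A′ M M′ N} → A ⇛ A′ → M ⇛ M′ → bind Q x A′ M′ ≈ N → bind Q x A M ⇛ N
    ⇛-β    : ∀ {x A M M′ N N′ P} → M ⇛ M′ → N ⇛ N′ → M′ [ x ≔ N′ ] ≈ P →
             (ƛ[ x ∶ A ] M) · N ⇛ P

  _⇛*_ : Rel Λ s
  _⇛*_ = Star _⇛_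

  ⇛-refl : ∀ M → M ⇛ M
  ⇛-refl (sort c) = ⇛-sort
  ⇛-refl (var x) = ⇛-var
  ⇛-refl (bind Q x A M) = ⇛-bind (⇛-refl A) (⇛-refl M) ≈-refl
  ⇛-refl (M · N) = ⇛-app (⇛-refl M) (⇛-refl N)

  ⇛-≈ : ∀ {M N P} → M ⇛ N → N ≈ P → M ⇛ P
  ⇛-≈ {P = P} ⇛-sort e with sort-≈⁻ P e
  ... | sort≈ = ⇛-sort
  ⇛-≈ {P = P} ⇛-var e with var-≈⁻ P e
  ... | var≈ = ⇛-var
  ⇛-≈ {P = P} (⇛-app dM dN) e with app-≈⁻ P e
  ... | app≈ eM eN = ⇛-app (⇛-≈ dM eM) (⇛-≈ dN eN)
  ⇛-≈ (⇛-bind dA dM e) e′ = ⇛-bind dA dM (≈-trans e e′)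
  ⇛-≈ (⇛-β dM dN e) e′ = ⇛-β dM dN (≈-trans e e′)

  ≈⇒⇛ : ∀ {M N} → M ≈ N → M ⇛ N
  ≈⇒⇛ = ⇛-≈ (⇛-refl _)

  remove-mono : ∀ {x} xs {ys} → xs ⊆ ys → xs - x ⊆ ys - x
  remove-mono xs xs⊆ys z∈ = let z∈xs , z≢x = ∈--⁻ xs z∈ in ∈--⁺ (xs⊆ys z∈xs) z≢x

  -- Keeps a name chosen fresh for a term fresh for its reducts.
  fv-⇛ : ∀ {M N} → M ⇛ N → fv N ⊆ fv M
  fv-⇛ ⇛-sort = id
  fv-⇛ ⇛-var = id
  fv-⇛ (⇛-app {M} {M′} dM dN) =
    [ ∈-++⁺ˡ ∘ fv-⇛ dM , ∈-++⁺ʳ (fv M) ∘ fv-⇛ dN ]′ ∘ ∈-++⁻ (fv M′)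
  fv-⇛ (⇛-bind {A = A} {A′} {M} {M′} dA dM e) =
    [ ∈-++⁺ˡ ∘ fv-⇛ dA , ∈-++⁺ʳ (fv A) ∘ remove-mono (fv M′) (fv-⇛ dM) ]′
    ∘ ∈-++⁻ (fv A′) ∘ fv-≈ (≈-sym e)
  fv-⇛ (⇛-β {x} {A} {M} {M′} {N} {N′} dM dN e) {z} z∈
    with image {y} y∈ z∈y ← fv-∙⁻ M′ (fv-≈ (≈-sym e) z∈)
    = upd-elim (λ L → z ∈ fv L → z ∈ fv ((ƛ[ x ∶ A ] M) · N)) ι y
        (λ { refl z∈N′ → ∈-++⁺ʳ (fv (ƛ[ x ∶ A ] M)) (fv-⇛ dN z∈N′) })
        (λ { y≢x (here refl) → ∈-++⁺ˡ (∈-++⁺ʳ (fv A) (∈--⁺ (fv-⇛ dM y∈) y≢x)) })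
        z∈y

  upd-⇛ : ∀ {σ τ x N N′} → (∀ z → σ z ⇛ τ z) → N ⇛ N′ → ∀ z → (σ , x ≔ N) z ⇛ (τ , x ≔ N′) z
  upd-⇛ {σ} {τ} {x} {N} {N′} σ⇛τ N⇛N′ z = upd-elim (_⇛ (τ , x ≔ N′) z) σ z
    (λ { refl → subst (N ⇛_) (sym (upd-≡ τ)) N⇛N′ })
    (λ z≢x → subst (σ z ⇛_) (sym (upd-≢ τ z≢x)) (σ⇛τ z))

  -- The two sides may choose different bound names. The one chosen for the source is still fresh
  -- for the reduct under `τ`, and the α-step stored in `⇛-bind` and `⇛-β` absorbs the difference.
  ⇛-∙ : ∀ {M N σ τ} → M ⇛ N → (∀ z → σ z ⇛ τ z) → M ∙ σ ⇛ N ∙ τ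
  ⇛-∙ ⇛-sort σ⇛τ = ⇛-sort
  ⇛-∙ ⇛-var σ⇛τ = σ⇛τ _
  ⇛-∙ (⇛-app dM dN) σ⇛τ = ⇛-app (⇛-∙ dM σ⇛τ) (⇛-∙ dN σ⇛τ)
  ⇛-∙ {σ = σ} {τ} (⇛-bind {x = x} {A′ = A′} {M} {M′} dA dM e) σ⇛τ =
    ⇛-bind (⇛-∙ dA σ⇛τ) (⇛-∙ dM (upd-⇛ σ⇛τ ⇛-var))
      (≈-trans (bind-∙-≈ A′ M′ w#) (≡⇒≈ (≈⇒∙≡ e τ)))
    where
    w# : Fresh τ x M′ (X σ (fv M - x))
    w# = avoid λ z∈ w∈ → X-fresh σ (remove-mono (fv M′) (fv-⇛ dM) z∈) (fv-⇛ (σ⇛τ _) w∈)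
  ⇛-∙ {σ = σ} {τ} (⇛-β {x} {M = M} {M′} {N} {N′} {P} dM dN e) σ⇛τ =
    ⇛-β (⇛-∙ dM (upd-⇛ σ⇛τ ⇛-var)) (⇛-∙ dN σ⇛τ)
      (≈-trans (≡⇒≈ (∙-open M′ w#))
        (≈-trans (∙-≈ M′ drop-ι)
          (≡⇒≈ (trans (sym (subst-∙ M′)) (≈⇒∙≡ e τ)))))
    where
    w# : Fresh τ x M′ (X σ (fv M - x))
    w# = avoid λ z∈ w∈ → X-fresh σ (remove-mono (fv M′) (fv-⇛ dM) z∈) (fv-⇛ (σ⇛τ _) w∈)
    -- `∙-open` produces `τ ⨟ ι`, which agrees with `τ` only up to α.
    drop-ι : ∀ z → ((τ ⨟ ι) , x ≔ (N′ ∙ τ)) z ≈ (τ , x ≔ (N′ ∙ τ)) z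
    drop-ι z = upd-elim (_≈ (τ , x ≔ (N′ ∙ τ)) z) (τ ⨟ ι) z
      (λ { refl → ≡⇒≈ (sym (upd-≡ τ)) })
      (λ z≢x → ≈-trans (∙ι-≈ (τ z)) (≡⇒≈ (sym (upd-≢ τ z≢x))))

  ⇛-subst : ∀ {M M′ x N N′} → M ⇛ M′ → N ⇛ N′ → M [ x ≔ N ] ⇛ M′ [ x ≔ N′ ]
  ⇛-subst dM dN = ⇛-∙ dM (upd-⇛ (λ _ → ⇛-var) dN)

  open-≡⇒≈ : ∀ {x x′} M M′ → (∀ σ P → M ∙ (σ , x ≔ P) ≡ M′ ∙ (σ , x′ ≔ P)) →
             M ≈ M′ [ x′ ≔ var x ]
  open-≡⇒≈ {x} M M′ eq = ≈-trans (≈-sym (∙ι-≈ M)) (≡⇒≈ (trans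
    (∙-agree M λ {z} _ → upd-elim (var z ≡_) ι z (cong var) (λ _ → refl))
    (eq ι (var x))))

  -- The recursion is on `M`: under a binder the given reduction is renamed to the bound name of
  -- `M`, after which it is no longer a subderivation.
  ≈-⇛ : ∀ M {N P} → M ≈ N → N ⇛ P → M ⇛ P
  ≈-⇛ (sort c) {N} e d with sort-≈⁻ N e
  ... | sort≈ = d
  ≈-⇛ (var x) {N} e d with var-≈⁻ N e
  ... | var≈ = d
  ≈-⇛ (bind Q x A M) {N} e d with bind-≈⁻ N e | d
  ... | bind≈ {M′ = M′} eA eM | ⇛-bind {A′ = A″} {M′ = M″} dA dM e′ =
    ⇛-bind (≈-⇛ A eA dA) (≈-⇛ M (open-≡⇒≈ M M′ eM) (⇛-subst dM ⇛-var))
      (≈-trans (bind-congʳ-≈ (≈-sym (∙ι-≈ A″)) ≈-refl)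
        (≈-trans (bind-rename A″ M″ (open-≡⇒bound-∉ M M′ eM ∘ remove-mono (fv M″) (fv-⇛ dM))) e′))
  ≈-⇛ (L · N) {P} e d with app-≈⁻ P e
  ≈-⇛ (L · N) e (⇛-app dL dN) | app≈ eL eN = ⇛-app (≈-⇛ L eL dL) (≈-⇛ N eN dN)
  ≈-⇛ (L · N) e (⇛-β {M = M′} {M″} dM dN e′) | app≈ eL eN
    with bind≈ {M′ = M} _ eM ← bind-≈⁻ L (≈-sym eL) =
    ⇛-β (≈-⇛ M (open-≡⇒≈ M M′ (λ σ P → sym (eM σ P))) (⇛-subst dM ⇛-var)) (≈-⇛ N eN dN)
      (≈-trans (≡⇒≈ (rename-open M″
          (open-≡⇒bound-∉ M M′ (λ σ P → sym (eM σ P)) ∘ remove-mono (fv M″) (fv-⇛ dM)))) e′)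

  -- Diamond property and confluence.

  -- By cases on both reductions; `≈-⇛` strips the stored α-steps off the two reducts before they
  -- are joined.
  diamond : ∀ {M N P} → M ⇛ N → M ⇛ P → ∃ λ Q → N ⇛ Q × P ⇛ Q
  diamond ⇛-sort ⇛-sort = _ , ⇛-sort , ⇛-sort
  diamond ⇛-var ⇛-var = _ , ⇛-var , ⇛-var
  diamond (⇛-app dM dN) (⇛-app dM′ dN′) =
    let _ , M⇛ , M⇛′ = diamond dM dM′
        _ , N⇛ , N⇛′ = diamond dN dN′
    in _ , ⇛-app M⇛ N⇛ , ⇛-app M⇛′ N⇛′
  diamond (⇛-app (⇛-bind {A′ = A′} _ dM e) dN) (⇛-β dM′ dN′ e′) =
    let _ , M⇛ , M⇛′ = diamond dM dM′
        _ , N⇛ , N⇛′ = diamond dN dN′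
    -- The uncontracted side is still a redex up to α; contracting it meets the other side.
    in _ , ≈-⇛ _ (≈-sym (·-≈ e ≈-refl)) (⇛-β M⇛ N⇛ ≈-refl)
         , ≈-⇛ _ (≈-sym e′) (⇛-subst M⇛′ N⇛′)
  diamond (⇛-β dM dN e) (⇛-app (⇛-bind _ dM′ e′) dN′) =
    let _ , M⇛ , M⇛′ = diamond dM dM′
        _ , N⇛ , N⇛′ = diamond dN dN′
    in _ , ≈-⇛ _ (≈-sym e) (⇛-subst M⇛ N⇛)
         , ≈-⇛ _ (≈-sym (·-≈ e′ ≈-refl)) (⇛-β M⇛′ N⇛′ ≈-refl)
  diamond (⇛-β dM dN e) (⇛-β dM′ dN′ e′) =
    let _ , M⇛ , M⇛′ = diamond dM dM′
        _ , N⇛ , N⇛′ = diamond dN dN′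
    in _ , ≈-⇛ _ (≈-sym e) (⇛-subst M⇛ N⇛) , ≈-⇛ _ (≈-sym e′) (⇛-subst M⇛′ N⇛′)
  diamond (⇛-bind dA dM e) (⇛-bind dA′ dM′ e′) =
    let _ , A⇛ , A⇛′ = diamond dA dA′
        _ , M⇛ , M⇛′ = diamond dM dM′
    in _ , ≈-⇛ _ (≈-sym e) (⇛-bind A⇛ M⇛ ≈-refl)
         , ≈-⇛ _ (≈-sym e′) (⇛-bind A⇛′ M⇛′ ≈-refl)

  strip : ∀ {M N P} → M ⇛ N → M ⇛* P → ∃ λ Q → N ⇛* Q × P ⇛ Q
  strip d ε = _ , ε , d
  strip d (d′ ◅ ds) =
    let _ , N⇛ , M′⇛ = diamond d d′
        _ , ⇛*Q , P⇛ = strip M′⇛ ds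
    in _ , N⇛ ◅ ⇛*Q , P⇛

  confluent : Confluent _⇛_
  confluent ε ds = _ , ds , ε
  confluent (d ◅ ds) ds′ =
    let _ , ⇛*Q , P⇛ = strip d ds′
        _ , N⇛* , Q⇛* = confluent ds ⇛*Q
    in _ , N⇛* , P⇛ ◅ Q⇛*

  -- Parallel reduction and β-conversion.

  ⟶β⇒⇛ : ∀ {M N} → M ⟶β N → M ⇛ N
  ⟶β⇒⇛ (redex β) = ⇛-β (⇛-refl _) (⇛-refl _) ≈-refl
  ⟶β⇒⇛ (appˡ r) = ⇛-app (⟶β⇒⇛ r) (⇛-refl _)
  ⟶β⇒⇛ (appʳ r) = ⇛-app (⇛-refl _) (⟶β⇒⇛ r)
  ⟶β⇒⇛ (dom r) = ⇛-bind (⟶β⇒⇛ r) (⇛-refl _) ≈-refl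
  ⟶β⇒⇛ (body r) = ⇛-bind (⇛-refl _) (⟶β⇒⇛ r) ≈-refl

  ⟶β=⇒⇛ : ∀ {M N} → M ⟶β= N → M ⇛ N
  ⟶β=⇒⇛ Refl.refl = ⇛-refl _
  ⟶β=⇒⇛ Refl.[ r ] = ⟶β⇒⇛ r

  open IsEquivalence (Eq.isEquivalence (_∼α_ ∪ _⟶β_)) public
    using () renaming (refl to ≃β-refl; sym to ≃β-sym; trans to ≃β-trans)

  ≈⇒≃β : ∀ {M N} → M ≈ N → M ≃β N
  ≈⇒≃β e = Eq.return (inj₁ (≈⇒∼α _ e))

  ≃β-app : ∀ {M M′ N N′} → M ≃β M′ → N ≃β N′ → M · N ≃β M′ · N′
  ≃β-app {M′ = M′} {N} M≃ N≃ = ≃β-trans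
    (Eq.gmap (_· N) [ (λ α → inj₁ (app α (≈⇒∼α N ≈-refl))) , inj₂ ∘ appˡ ]′ M≃)
    (Eq.gmap (M′ ·_) [ (λ α → inj₁ (app (≈⇒∼α M′ ≈-refl) α)) , inj₂ ∘ appʳ ]′ N≃)

  ≃β-bind : ∀ {Q x A A′ M M′} → A ≃β A′ → M ≃β M′ → bind Q x A M ≃β bind Q x A′ M′
  ≃β-bind {Q} {x} {A′ = A′} {M} A≃ M≃ = ≃β-trans
    (Eq.gmap (λ A → bind Q x A M)
      [ (λ α → inj₁ (≈⇒∼α _ (bind-congʳ-≈ (∼α⇒≈ α) ≈-refl))) , inj₂ ∘ dom ]′ A≃)
    (Eq.gmap (bind Q x A′)
      [ (λ α → inj₁ (≈⇒∼α _ (bind-congʳ-≈ ≈-refl (∼α⇒≈ α)))) , inj₂ ∘ body ]′ M≃)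

  ⇛⇒≃β : ∀ {M N} → M ⇛ N → M ≃β N
  ⇛⇒≃β ⇛-sort = ≃β-refl
  ⇛⇒≃β ⇛-var = ≃β-refl
  ⇛⇒≃β (⇛-app dM dN) = ≃β-app (⇛⇒≃β dM) (⇛⇒≃β dN)
  ⇛⇒≃β (⇛-bind dA dM e) = ≃β-trans (≃β-bind (⇛⇒≃β dA) (⇛⇒≃β dM)) (≈⇒≃β e)
  ⇛⇒≃β (⇛-β dM dN e) = ≃β-trans
    (≃β-app (≃β-bind ≃β-refl (⇛⇒≃β dM)) (⇛⇒≃β dN))
    (≃β-trans (Eq.return (inj₂ (redex β))) (≈⇒≃β e))

  step⇒⇛ : ∀ {M N} → (_∼α_ ∪ _⟶β_) M N → M ⇛ N
  step⇒⇛ = [ ≈⇒⇛ ∘ ∼α⇒≈ , ⟶β⇒⇛ ]′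

  ≃β-∙ : ∀ {M N} σ → M ≃β N → M ∙ σ ≃β N ∙ σ
  ≃β-∙ σ = Eq.gfold (Eq.isEquivalence _) (_∙ σ)
    (λ r → ⇛⇒≃β (⇛-∙ (step⇒⇛ r) (λ z → ⇛-refl (σ z))))

  -- Church-Rosser and injectivity of binders.

  Joinable : Rel Λ s
  Joinable M N = ∃ λ P → M ⇛* P × N ⇛* P

  Joinable-isEquivalence : IsEquivalence Joinable
  Joinable-isEquivalence = record
    { refl  = _ , ε , ε
    ; sym   = λ (_ , ds , ds′) → _ , ds′ , ds
    ; trans = λ (_ , ds₁ , ds₂) (_ , ds₃ , ds₄) →
        let _ , es , es′ = confluent ds₂ ds₃ in _ , ds₁ ◅◅ es , ds₄ ◅◅ es′
    }

  church-rosser : ∀ {M N} → M ≃β N → Joinable M N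
  church-rosser = Eq.fold Joinable-isEquivalence (λ r → _ , step⇒⇛ r ◅ ε , ε)

  -- The bound name may change along `R`, so bodies are compared through their instances. Used with
  -- `≈`, `⇛` and `≃β` for `R`.
  data BindStep (R : Rel Λ s) (Q : Binder) (x : V) (A M : Λ) : Λ → Set s where
    bindStep : ∀ {x′ A′ M′} → R A A′ → (∀ N → R (M [ x ≔ N ]) (M′ [ x′ ≔ N ])) →
               BindStep R Q x A M (bind Q x′ A′ M′)

  bind-≈-step : ∀ {Q x A M N} → bind Q x A M ≈ N → BindStep _≈_ Q x A M N
  bind-≈-step {N = N} e with bind-≈⁻ N e
  ... | bind≈ eA eM = bindStep eA (λ P → ≡⇒≈ (eM ι P))

  bind-⇛-step : ∀ {Q x A M N} → bind Q x A M ⇛ N → BindStep _⇛_ Q x A M N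
  bind-⇛-step (⇛-bind dA dM e) with bind-≈-step e
  ... | bindStep eA eM =
    bindStep (⇛-≈ dA eA) (λ P → ⇛-≈ (⇛-subst dM (⇛-refl P)) (eM P))

  bind-⇛*-step : ∀ {Q x A M N} → bind Q x A M ⇛* N → BindStep _≃β_ Q x A M N
  bind-⇛*-step ε = bindStep ≃β-refl (λ _ → ≃β-refl)
  bind-⇛*-step (d ◅ ds) with bind-⇛-step d
  ... | bindStep A⇛ M⇛ with bind-⇛*-step ds
  ...   | bindStep A≃ M≃ =
    bindStep (≃β-trans (⇛⇒≃β A⇛) A≃) (λ N → ≃β-trans (⇛⇒≃β (M⇛ N)) (M≃ N))

  -- Church-Rosser gives a common reduct; it is again a binder, with parts convertible to those of
  -- either side.
  bind-injective-≃β : ∀ {Q x x′ A A′ M M′} → bind Q x A M ≃β bind Q x′ A′ M′ →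
                      A ≃β A′ × (∀ N → M [ x ≔ N ] ≃β M′ [ x′ ≔ N ])
  bind-injective-≃β eq with church-rosser eq
  ... | _ , ds , ds′ with bind-⇛*-step ds | bind-⇛*-step ds′
  ...   | bindStep A≃ M≃ | bindStep A≃′ M≃′ =
    ≃β-trans A≃ (≃β-sym A≃′) , λ N → ≃β-trans (M≃ N) (≃β-sym (M≃′ N))

module TypingProperties (𝒱 : Variables) {s a r : Level} (𝒫 : PTS s a r) where

  open Variables 𝒱
  open PTS 𝒫
  open Typing 𝒱 𝒫
  open TermProperties 𝒱 Sort
  open ParallelReduction 𝒱 Sort

  -- Free variables of typed terms.

  ⊢⇒ok : ∀ {Γ M A} → Γ ⊢ M ∶ A → Γ ok
  ⊢⇒ok (sort wf _) = wf
  ⊢⇒ok (var wf _) = wf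
  ⊢⇒ok (prod _ dA _ _ _) = ⊢⇒ok dA
  ⊢⇒ok (abs _ dA _ _ _ _ _) = ⊢⇒ok dA
  ⊢⇒ok (app dM _) = ⊢⇒ok dM
  ⊢⇒ok (conv dM _ _) = ⊢⇒ok dM

  fv-unopen : ∀ M {x y zs} → y ∉ fv M - x → fv (M [ x ≔ var y ]) ⊆ y ∷ zs → fv M - x ⊆ zs
  fv-unopen M y∉ ⊆zs z∈ with ⊆zs (fv-∙⁺ M (body-Image M (image z∈ (here refl))))
  ... | here refl = contradiction z∈ y∉
  ... | there z∈zs = z∈zs

  fv-⊢ : ∀ {Γ M A} → Γ ⊢ M ∶ A → fv M ⊆ domain Γ
  fv-⊢ (var _ x∈) (here refl) = ∈-map⁺ proj₁ x∈
  fv-⊢ (prod {A = A} {B} y dA dB _ y∉) =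
    [ fv-⊢ dA , fv-unopen B y∉ (fv-⊢ dB) ]′ ∘ ∈-++⁻ (fv A)
  fv-⊢ (abs {A = A} {M = M} z dA dM _ _ z∉ _) =
    [ fv-⊢ dA , fv-unopen M z∉ (fv-⊢ dM) ]′ ∘ ∈-++⁻ (fv A)
  fv-⊢ (app {M = M} dM dN) = [ fv-⊢ dM , fv-⊢ dN ]′ ∘ ∈-++⁻ (fv M)
  fv-⊢ (conv dM _ _) = fv-⊢ dM

  fv-ok : ∀ {Γ x A} → Γ ok → (x , A) ∈ Γ → fv A ⊆ domain Γ
  fv-ok (ext wf dA _) (here refl) = there ∘ fv-⊢ dA
  fv-ok (ext wf _ _) (there x∈) = there ∘ fv-ok wf x∈

  -- Environments and the substitution lemma.

  -- Makes `σ ⨟ ι` agree with `σ` syntactically, as `open-∙` requires.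
  Normal : Substitution → Set s
  Normal σ = ∀ z → σ z ∙ ι ≡ σ z

  -- Quantifying over the extensions Δ′ lets an environment pass under binders
  -- before weakening is available. Without normality, B [ x ≔ N ] ∙ σ and the
  -- type that (app) gives to (M · N) ∙ σ would only be α-convertible.
  record Env (Δ : Context) (σ : Substitution) (Γ : Context) : Set (s ⊔ a ⊔ r) where
    field
      lookup : ∀ {x A Δ′} → (x , A) ∈ Γ → Δ ⊆ Δ′ → Δ′ ok → Δ′ ⊢ σ x ∶ A ∙ σ
      normal : Normal σ
  open Env

  env-weaken : ∀ {Γ Δ Δ′ σ} → Δ ⊆ Δ′ → Env Δ σ Γ → Env Δ′ σ Γ
  env-weaken Δ⊆ env = record
    { lookup = λ x∈ Δ′⊆ → lookup env x∈ (Δ′⊆ ∘ Δ⊆) ; normal = normal env }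

  env-extend : ∀ {Γ Δ σ y A N} → (Γ ▸ y ∶ A) ok → Env Δ σ Γ → N ∙ ι ≡ N →
               (∀ {Δ′} → Δ ⊆ Δ′ → Δ′ ok → Δ′ ⊢ N ∶ A ∙ σ) →
               Env Δ (σ , y ≔ N) (Γ ▸ y ∶ A)
  env-extend {Γ} {Δ} {σ} {y} {A} {N} (ext wf dA y∉) env N-normal dN = record
    { lookup = lookup′
    ; normal = λ z → upd-elim (λ L → L ∙ ι ≡ L) σ z (λ _ → N-normal) (λ _ → normal env z)
    }
    where
    lookup′ : ∀ {x C Δ′} → (x , C) ∈ Γ ▸ y ∶ A → Δ ⊆ Δ′ → Δ′ ok →
              Δ′ ⊢ (σ , y ≔ N) x ∶ C ∙ (σ , y ≔ N)
    -- `y` is outside `domain Γ`, hence not free in `A` or in any type declared in `Γ`: the update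
    -- leaves these types alone.
    lookup′ (here refl) Δ⊆ wf′ = subst₂ (_ ⊢_∶_)
      (sym (upd-≡ σ)) (sym (∙-upd-∉ A (y∉ ∘ fv-⊢ dA))) (dN Δ⊆ wf′)
    lookup′ {C = C} (there x∈) Δ⊆ wf′ = subst₂ (_ ⊢_∶_)
      (sym (upd-≢ σ λ { refl → y∉ (∈-map⁺ proj₁ x∈) }))
      (sym (∙-upd-∉ C (y∉ ∘ fv-ok wf x∈)))
      (lookup env x∈ Δ⊆ wf′)

  open-∙ : ∀ M σ {x N} → Normal σ →
           (M ∙ (σ , x ≔ var (X σ (fv M - x)))) [ X σ (fv M - x) ≔ N ] ≡ M ∙ (σ , x ≔ N)
  open-∙ M σ σ-normal =
    trans (∙-open M X-Fresh) (∙-upd-agree M {σ ⨟ ι} {σ} (λ {z} _ → σ-normal z))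

  rename-∙ : ∀ M σ {x y v} → Normal σ → y ∉ fv M - x →
             (M [ x ≔ var y ]) ∙ (σ , y ≔ var v) ≡
             (M ∙ (σ , x ≔ var (X σ (fv M - x)))) [ X σ (fv M - x) ≔ var v ]
  rename-∙ M σ σ-normal y∉ = trans (rename-open M y∉) (sym (open-∙ M σ σ-normal))

  ⊢-open : ∀ {Γ x x′ y v} σ M A → Normal σ → y ∉ fv M - x → y ∉ fv A - x′ →
           Γ ⊢ (M [ x ≔ var y ]) ∙ (σ , y ≔ var v) ∶ (A [ x′ ≔ var y ]) ∙ (σ , y ≔ var v) →
           Γ ⊢ (M ∙ (σ , x ≔ var (X σ (fv M - x)))) [ X σ (fv M - x) ≔ var v ]
             ∶ (A ∙ (σ , x′ ≔ var (X σ (fv A - x′)))) [ X σ (fv A - x′) ≔ var v ]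
  ⊢-open {Γ} σ M A σ-normal y∉M y∉A =
    subst₂ (Γ ⊢_∶_) (rename-∙ M σ σ-normal y∉M) (rename-∙ A σ σ-normal y∉A)

  -- Kept abstract, since unfolding the search for a name is expensive.
  abstract
    ∃fresh : (zs : List V) → ∃ λ v → v ∉ zs
    ∃fresh zs = fresh zs , fresh-∉ zs

  env-binder : ∀ {Γ Δ σ y A c} v → (Γ ▸ y ∶ A) ok → Δ ⊢ A ∙ σ ∶ sort c → v ∉ domain Δ →
               Env Δ σ Γ → Env (Δ ▸ v ∶ (A ∙ σ)) (σ , y ≔ var v) (Γ ▸ y ∶ A)
  env-binder v wf dA v∉ env =
    env-extend wf (env-weaken there env) refl (λ Δ⊆ wf′ → var wf′ (Δ⊆ (here refl)))

  -- Under a binder the variable of the premise is sent to a name `v` fresh for the target context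
  -- and the substituted bodies; `v` becomes the variable of the new premise.
  substitution : ∀ {Γ Δ M A σ} → Γ ⊢ M ∶ A → Δ ok → Env Δ σ Γ → Δ ⊢ M ∙ σ ∶ A ∙ σ
  substitution (sort _ ax) wf env = sort wf ax
  substitution (var _ x∈) wf env = lookup env x∈ id wf
  substitution {Δ = Δ} {σ = σ} (prod {x = x} {B = B} {s₂ = s₂} y dA dB rule y∉) wf env =
    prod v dA′
      -- A sort has no free variables, so it counts as a body opened at any bound name.
      (⊢-open {x′ = x} σ B (sort s₂) (normal env) y∉ (λ ())
        (substitution dB (ext wf dA′ (v∉ ∘ ∈-++⁺ˡ))
          (env-binder v (⊢⇒ok dB) dA′ (v∉ ∘ ∈-++⁺ˡ) env)))
      rule (v∉ ∘ ∈-++⁺ʳ (domain Δ))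
    where
    dA′ = substitution dA wf env
    w = X σ (fv B - x)
    zs = domain Δ ++ (fv (B ∙ (σ , x ≔ var w)) - w)
    v = proj₁ (∃fresh zs)
    v∉ : v ∉ zs
    v∉ = proj₂ (∃fresh zs)
  substitution {Δ = Δ} {σ = σ} (abs {x = x} {y} {B = B} {M} {s₂ = s₂} z dA dM dB rule z∉M z∉B) wf env =
    abs v dA′
      (⊢-open σ M B (normal env) z∉M z∉B (substitution dM wf′ env′))
      (⊢-open {x′ = y} σ B (sort s₂) (normal env) z∉B (λ ()) (substitution dB wf′ env′))
      rule (v∉ ∘ ∈-++⁺ʳ (domain Δ) ∘ ∈-++⁺ˡ) (v∉ ∘ ∈-++⁺ʳ (domain Δ) ∘ ∈-++⁺ʳ fvM)
    where
    dA′ = substitution dA wf env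
    wM = X σ (fv M - x)
    wB = X σ (fv B - y)
    fvM = fv (M ∙ (σ , x ≔ var wM)) - wM
    zs = domain Δ ++ fvM ++ (fv (B ∙ (σ , y ≔ var wB)) - wB)
    v = proj₁ (∃fresh zs)
    v∉ : v ∉ zs
    v∉ = proj₂ (∃fresh zs)
    wf′ = ext wf dA′ (v∉ ∘ ∈-++⁺ˡ)
    env′ = env-binder v (⊢⇒ok dM) dA′ (v∉ ∘ ∈-++⁺ˡ) env
  substitution {σ = σ} (app {B = B} dM dN) wf env =
    -- The type given by (app) and the expected one both equal `B ∙ (σ , x ≔ (N ∙ σ))`.
    subst (_ ⊢ _ ∶_) (trans (open-∙ B σ (normal env)) (sym (subst-∙ B)))
      (app (substitution dM wf env) (substitution dN wf env))
  substitution (conv dM dB eq) wf env =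
    conv (substitution dM wf env) (substitution dB wf env) (≃β-∙ _ eq)

  -- Change of context and instantiation of premises.

  infix 4 _⊑_

  -- Covers both weakening and replacing declared types by convertible ones.
  _⊑_ : Context → Context → Set s
  Γ ⊑ Δ = ∀ {x A} → (x , A) ∈ Γ → ∃ λ A′ → (x , A′) ∈ Δ × A′ ≃β A

  ⊑-refl : ∀ {Γ} → Γ ⊑ Γ
  ⊑-refl x∈ = _ , x∈ , ≃β-refl

  -- By induction on the context: the conversion to `A ∙ ι` needs a sort for it in `Δ′`, obtained by
  -- substitution along the environment of the shorter context.
  env-ι : ∀ {Γ Δ} → Γ ok → Γ ⊑ Δ → Env Δ ι Γ
  env-ι [] Γ⊑Δ = record { lookup = λ () ; normal = λ _ → refl }
  env-ι {Γ ▸ y ∶ A} {Δ} (ext wf dA _) Γ⊑Δ = record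
    { lookup = lookup′ ; normal = λ _ → refl }
    where
    env : Env Δ ι Γ
    env = env-ι wf (Γ⊑Δ ∘ there)
    lookup′ : ∀ {x C Δ′} → (x , C) ∈ Γ ▸ y ∶ A → Δ ⊆ Δ′ → Δ′ ok → Δ′ ⊢ var x ∶ C ∙ ι
    lookup′ (here refl) Δ⊆ wf′ =
      let _ , y∈ , eq = Γ⊑Δ (here refl)
      in conv (var wf′ (Δ⊆ y∈)) (substitution dA wf′ (env-weaken Δ⊆ env))
           (≃β-trans eq (≈⇒≃β (≈-sym (∙ι-≈ A))))
    lookup′ (there x∈) = lookup env x∈

  ⊢-⊑-ι : ∀ {Γ Δ M A} → Γ ⊢ M ∶ A → Δ ok → Γ ⊑ Δ → Δ ⊢ M ∙ ι ∶ A ∙ ι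
  ⊢-⊑-ι d wf Γ⊑Δ = substitution d wf (env-ι (⊢⇒ok d) Γ⊑Δ)

  ⊢-ι : ∀ {Γ M A} → Γ ⊢ M ∶ A → Γ ⊢ M ∙ ι ∶ A ∙ ι
  ⊢-ι d = ⊢-⊑-ι d (⊢⇒ok d) ⊑-refl

  -- The environment sends `z` to `N ∙ ι`, since its values must be canonical; this is why the
  -- conclusion is in canonical form.
  instantiate : ∀ {Γ x y z A N} M B → Γ ▸ z ∶ A ⊢ M [ x ≔ var z ] ∶ B [ y ≔ var z ] →
                z ∉ fv M - x → z ∉ fv B - y → Γ ⊢ N ∶ A →
                Γ ⊢ (M [ x ≔ N ]) ∙ ι ∶ (B [ y ≔ N ]) ∙ ι
  instantiate {Γ} {N = N} M B dM z∉M z∉B dN =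
    subst₂ (Γ ⊢_∶_) (trans (rename-open M z∉M) (sym (subst-∙ M)))
                    (trans (rename-open B z∉B) (sym (subst-∙ B)))
      (substitution dM (⊢⇒ok dN) (env-extend {N = N ∙ ι} (⊢⇒ok dM) (env-ι (⊢⇒ok dN) ⊑-refl)
        (∙-∙ N) (λ Γ⊆ wf → ⊢-⊑-ι dN wf (λ x∈ → _ , Γ⊆ x∈ , ≃β-refl))))

  -- Generation and correctness of types.

  generation-Π : ∀ {Γ x A B C} → Γ ⊢ Π[ x ∶ A ] B ∶ C →
                 ∃ λ s₁ → ∃ λ s₂ → ∃ λ y → Γ ⊢ A ∶ sort s₁ ×
                 Γ ▸ y ∶ A ⊢ B [ x ≔ var y ] ∶ sort s₂ × y ∉ fv B - x
  generation-Π (prod y dA dB _ y∉) = _ , _ , y , dA , dB , y∉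
  generation-Π (conv d _ _) = generation-Π d

  data Abs (Γ : Context) (x : V) (A M C : Λ) : Set (s ⊔ a ⊔ r) where
    abs : ∀ {y z B s₁} → Γ ⊢ A ∶ sort s₁ → Γ ▸ z ∶ A ⊢ M [ x ≔ var z ] ∶ B [ y ≔ var z ] →
          z ∉ fv M - x → z ∉ fv B - y → Π[ y ∶ A ] B ≃β C → Abs Γ x A M C

  generation-ƛ : ∀ {Γ x A M C} → Γ ⊢ ƛ[ x ∶ A ] M ∶ C → Abs Γ x A M C
  generation-ƛ (abs z dA dM _ _ z∉M z∉B) = abs dA dM z∉M z∉B ≃β-refl
  generation-ƛ (conv d _ eq) with generation-ƛ d
  ... | abs dA dM z∉M z∉B eq′ = abs dA dM z∉M z∉B (≃β-trans eq′ eq)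

  Sorted : Context → Λ → Set (s ⊔ a ⊔ r)
  Sorted Γ A = ∃ λ c → Γ ⊢ A ∶ sort c

  sorted-instance : ∀ {Γ x A B N} → Sorted Γ ((Π[ x ∶ A ] B) ∙ ι) → Γ ⊢ N ∶ A →
                    Sorted Γ ((B [ x ≔ N ]) ∙ ι)
  sorted-instance {Γ} {x} {A} {B} (_ , d) dN =
    let _ , s₂ , _ , dA , dB , y∉ = generation-Π d
    in s₂ , subst (λ L → Γ ⊢ L ∙ ι ∶ sort s₂) (open-∙ B ι (λ _ → refl))
              (instantiate {y = x} (B ∙ (ι , x ≔ var (X ι (fv B - x)))) (sort s₂) dB y∉ (λ ())
                -- The inverted product has domain `A ∙ ι`.
                (conv dN dA (≈⇒≃β (≈-sym (∙ι-≈ A)))))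

  -- The variable and application cases go through substitution, which yields the type only in
  -- canonical form.
  correctness-ι : ∀ {Γ M A} → Γ ⊢ M ∶ A → (∃ λ c → A ≡ sort c) ⊎ Sorted Γ (A ∙ ι)
  sorted-codomain : ∀ {Γ x A B M N} → Γ ⊢ M ∶ Π[ x ∶ A ] B → Γ ⊢ N ∶ A →
                    Sorted Γ ((B [ x ≔ N ]) ∙ ι)

  correctness-ι (sort _ _) = inj₁ (_ , refl)
  correctness-ι {Γ} (var wf x∈) = inj₂ (var-sorted wf x∈ wf id)
    where
    var-sorted : ∀ {Δ x A} → Δ ok → (x , A) ∈ Δ → Γ ok → Δ ⊆ Γ → Sorted Γ (A ∙ ι)
    var-sorted (ext _ dA _) (here refl) wf Δ⊆ =
      _ , ⊢-⊑-ι dA wf (λ x∈ → _ , Δ⊆ (there x∈) , ≃β-refl)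
    var-sorted (ext wf′ _ _) (there x∈) wf Δ⊆ = var-sorted wf′ x∈ wf (Δ⊆ ∘ there)
  correctness-ι (prod _ _ _ _ _) = inj₁ (_ , refl)
  correctness-ι (abs {y = y} {B = B} z dA _ dB rule _ z∉B) =
    inj₂ (_ , ⊢-ι (prod {x = y} {B = B} z dA dB rule z∉B))
  correctness-ι (app dM dN) = inj₂ (sorted-codomain dM dN)
  correctness-ι (conv _ dB _) = inj₂ (_ , ⊢-ι dB)

  sorted-codomain {x = x} {A} {B} dM dN with correctness-ι dM
  ... | inj₁ (_ , ())
  ... | inj₂ dΠ = sorted-instance {x = x} {A} {B} dΠ dN

  -- Preservation of types under α and parallel reduction.

  -- (app) instantiates the codomain at `N′`; conversion restores the instance at `N`, whose sort
  -- comes from the original derivations.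
  app-step : ∀ {Γ x A B M M′ N N′} → Γ ⊢ M ∶ Π[ x ∶ A ] B → Γ ⊢ N ∶ A →
             Γ ⊢ M′ ∶ (Π[ x ∶ A ] B) ∙ ι → Γ ⊢ N′ ∶ A ∙ ι → N ⇛ N′ →
             Γ ⊢ M′ · N′ ∶ (B [ x ≔ N ]) ∙ ι
  app-step {B = B} dM dN dM′ dN′ N⇛N′ =
    conv (app dM′ dN′) (proj₂ (sorted-codomain dM dN))
      (≃β-trans (≈⇒≃β (≡⇒≈ (open-∙ B ι (λ _ → refl))))
        (≃β-trans (≃β-sym (⇛⇒≃β (⇛-subst (⇛-refl B) N⇛N′))) (≈⇒≃β (≈-sym (∙ι-≈ _)))))

  change-domain : ∀ {Γ y A A′ c M C} → Γ ⊢ A′ ∶ sort c → A ≃β A′ → Γ ▸ y ∶ A ⊢ M ∶ C →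
                  Γ ▸ y ∶ A′ ⊢ M ∙ ι ∶ C ∙ ι
  change-domain dA′ A≃ d with ⊢⇒ok d
  ... | ext wf _ y∉ = ⊢-⊑-ι d (ext wf dA′ y∉) λ
    { (here refl) → _ , here refl , ≃β-sym A≃
    ; (there x∈) → _ , there x∈ , ≃β-refl }

  -- Instantiated with α-conversion first: the redex case of parallel reduction
  -- relies on invariance of typing under α.
  record Preservable (R : Rel Λ s) : Set (s ⊔ a ⊔ r) where
    field
      ⇒⇛     : ∀ {M N} → R M N → M ⇛ N
      bind⁻  : ∀ {Q x A M N} → R (bind Q x A M) N → BindStep R Q x A M N
      app⁻   : ∀ {Γ x A B M N P} → Γ ⊢ M ∶ Π[ x ∶ A ] B → Γ ⊢ N ∶ A →
               (∀ {M′} → R M M′ → Γ ⊢ M′ ∶ (Π[ x ∶ A ] B) ∙ ι) →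
               (∀ {N′} → R N N′ → Γ ⊢ N′ ∶ A ∙ ι) →
               R (M · N) P → Γ ⊢ P ∶ (B [ x ≔ N ]) ∙ ι

  module _ {R : Rel Λ s} (preservable : Preservable R) where
    open Preservable preservable

    preservation-ι : ∀ {Γ M N A} → Γ ⊢ M ∶ A → R M N → Γ ⊢ N ∶ A ∙ ι
    preservation-ι (sort wf ax) R-MN with ⇒⇛ R-MN
    ... | ⇛-sort = sort wf ax
    preservation-ι (var wf x∈) R-MN with ⇒⇛ R-MN
    ... | ⇛-var = ⊢-ι (var wf x∈)
    preservation-ι (prod {x = x} {B = B} {s₂ = s₂} y dA dB rule y∉) R-MN with bind⁻ R-MN
    ... | bindStep {M′ = B′} R-A R-B =
      prod y dA′
        -- A body opened with a variable is already canonical, so `_∙ ι` disappears.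
        (subst (_ ⊢_∶ _) (subst-∙ B′)
          (change-domain dA′ (⇛⇒≃β (⇒⇛ R-A)) (preservation-ι dB (R-B (var y)))))
        rule (y∉ ∘ fv-open-⊆ B B′ (λ u → fv-⇛ (⇒⇛ (R-B (var u)))))
      where dA′ = preservation-ι dA R-A
    preservation-ι (abs {y = y} {B = B} {M = M} z dA dM dB rule z∉M z∉B) R-MN with bind⁻ R-MN
    ... | bindStep {M′ = M′} R-A R-M =
      -- The reduct gets a product with domain `A′`, converted back to the original product.
      conv
        (abs {y = y} {B = B} {M = M′} z dA′
          (subst₂ (_ ⊢_∶_) (subst-∙ M′) (trans (cong (_∙ ι) (subst-∙ B)) (subst-∙ B))
            (change-domain dA′ A≃ (preservation-ι dM (R-M (var z)))))
          (subst (_ ⊢_∶ _) (subst-∙ B) (change-domain dA′ A≃ dB))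
          rule (z∉M ∘ fv-open-⊆ M M′ (λ u → fv-⇛ (⇒⇛ (R-M (var u))))) z∉B)
        (⊢-ι (prod {x = y} {B = B} z dA dB rule z∉B))
        (≃β-trans (≃β-bind (≃β-sym A≃) ≃β-refl) (≈⇒≃β (≈-sym (∙ι-≈ _))))
      where
      dA′ = preservation-ι dA R-A
      A≃ = ⇛⇒≃β (⇒⇛ R-A)
    preservation-ι (app dM dN) R-MN =
      app⁻ dM dN (preservation-ι dM) (preservation-ι dN) R-MN
    preservation-ι (conv dM dB eq) R-MN =
      conv (preservation-ι dM R-MN) (⊢-ι dB) (≃β-∙ ι eq)

  ≈-preservable : Preservable _≈_
  ≈-preservable = record { ⇒⇛ = ≈⇒⇛ ; bind⁻ = bind-≈-step ; app⁻ = app⁻ }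
    where
    app⁻ : ∀ {Γ x A B M N P} → Γ ⊢ M ∶ Π[ x ∶ A ] B → Γ ⊢ N ∶ A →
           (∀ {M′} → M ≈ M′ → Γ ⊢ M′ ∶ (Π[ x ∶ A ] B) ∙ ι) →
           (∀ {N′} → N ≈ N′ → Γ ⊢ N′ ∶ A ∙ ι) →
           M · N ≈ P → Γ ⊢ P ∶ (B [ x ≔ N ]) ∙ ι
    app⁻ {P = P} dM dN ihM ihN e with app-≈⁻ P e
    ... | app≈ eM eN = app-step dM dN (ihM eM) (ihN eN) (≈⇒⇛ eN)

  α-invariance-ι : ∀ {Γ M N A} → Γ ⊢ M ∶ A → M ≈ N → Γ ⊢ N ∶ A ∙ ι
  α-invariance-ι = preservation-ι ≈-preservable

  ⇛-preservable : Preservable _⇛_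
  ⇛-preservable = record { ⇒⇛ = id ; bind⁻ = bind-⇛-step ; app⁻ = app⁻ }
    where
    app⁻ : ∀ {Γ x A B M N P} → Γ ⊢ M ∶ Π[ x ∶ A ] B → Γ ⊢ N ∶ A →
           (∀ {M′} → M ⇛ M′ → Γ ⊢ M′ ∶ (Π[ x ∶ A ] B) ∙ ι) →
           (∀ {N′} → N ⇛ N′ → Γ ⊢ N′ ∶ A ∙ ι) →
           M · N ⇛ P → Γ ⊢ P ∶ (B [ x ≔ N ]) ∙ ι
    app⁻ dM dN ihM ihN (⇛-app M⇛ N⇛) = app-step dM dN (ihM M⇛) (ihN N⇛) N⇛
    app⁻ {B = B} dM dN ihM ihN (⇛-β {A = A₀} {M′ = L′} {N′ = N′} L⇛ N⇛ e)
      -- Inverting the abstraction with reduced body types `L′` at its own domain `A₀`; injectivity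
      -- of Π then relates `A₀` to `A` and `B₀` to `B`.
      with abs {y} {B = B₀} dA₀ dL z∉L z∉B₀ eq ← generation-ƛ (ihM (⇛-bind (⇛-refl A₀) L⇛ ≈-refl)) =
      let A≃ , B≃ = bind-injective-≃β eq
          dN′ = conv (ihN N⇛) dA₀ (≃β-sym A≃)
          dP = α-invariance-ι (instantiate L′ B₀ dL z∉L z∉B₀ dN′) (≈-trans (∙ι-≈ _) e)
      in conv dP (proj₂ (sorted-codomain dM dN))
           -- `instantiate` and α-invariance each add a `_∙ ι`. The chain then runs from `B₀` to `B`
           -- at `N′`, and from `N′` back to `N`.
           (≃β-trans (≈⇒≃β (≈-trans (∙ι-≈ _) (∙ι-≈ _)))
             (≃β-trans (B≃ N′)
               (≃β-trans (≈⇒≃β (≡⇒≈ (open-∙ B ι (λ _ → refl))))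
                 (≃β-trans (≃β-sym (⇛⇒≃β (⇛-subst (⇛-refl B) N⇛)))
                   (≈⇒≃β (≈-sym (∙ι-≈ _)))))))

  -- Subject reduction at the original types and in reduced contexts.

  correctness : ∀ {Γ M A} → Γ ⊢ M ∶ A → (∃ λ c → A ≡ sort c) ⊎ Sorted Γ A
  correctness {A = A} d =
    [ inj₁ , (λ (_ , dA) → inj₂ (_ , α-invariance-ι dA (∙ι-≈ A))) ]′ (correctness-ι d)

  from-ι : ∀ {Γ M A} → (∃ λ c → A ≡ sort c) ⊎ Sorted Γ A → Γ ⊢ M ∶ A ∙ ι → Γ ⊢ M ∶ A
  from-ι (inj₁ (_ , refl)) d = d
  from-ι (inj₂ (_ , dA)) d = conv d dA (≈⇒≃β (∙ι-≈ _))

  subject-⇛ : ∀ {Γ M N A} → Γ ⊢ M ∶ A → M ⇛ N → Γ ⊢ N ∶ A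
  subject-⇛ d M⇛N = from-ι (correctness d) (preservation-ι ⇛-preservable d M⇛N)

  -- A sort is its own canonical form, so α-invariance alone suffices here; `⊢-⊑` uses this case to
  -- retype `A` in `Δ`.
  ⊢-⊑-sort : ∀ {Γ Δ A c} → Γ ⊢ A ∶ sort c → Δ ok → Γ ⊑ Δ → Δ ⊢ A ∶ sort c
  ⊢-⊑-sort d wf Γ⊑Δ = α-invariance-ι (⊢-⊑-ι d wf Γ⊑Δ) (∙ι-≈ _)

  ⊢-⊑ : ∀ {Γ Δ M A} → Γ ⊢ M ∶ A → Δ ok → Γ ⊑ Δ → Δ ⊢ M ∶ A
  ⊢-⊑ {M = M} {A} d wf Γ⊑Δ = from-ι
    ([ inj₁ , (λ (_ , dA) → inj₂ (_ , ⊢-⊑-sort dA wf Γ⊑Δ)) ]′ (correctness d))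
    (subst (_ ⊢ M ∶_) (∙-∙ A) (α-invariance-ι (⊢-⊑-ι d wf Γ⊑Δ) (∙ι-≈ M)))

  ⟶⟶β=⇒⊑ : ∀ {Γ Δ} → Γ ⟶⟶β= Δ → Γ ⊑ Δ
  ⟶⟶β=⇒⊑ ((refl , A⟶) ∷ rs) (here refl) = _ , here refl , ≃β-sym (⇛⇒≃β (⟶β=⇒⇛ A⟶))
  ⟶⟶β=⇒⊑ (_ ∷ rs) (there x∈) = let _ , x∈′ , eq = ⟶⟶β=⇒⊑ rs x∈ in _ , there x∈′ , eq

  domain-⟶⟶β= : ∀ {Γ Δ} → Γ ⟶⟶β= Δ → domain Γ ≡ domain Δ
  domain-⟶⟶β= [] = refl
  domain-⟶⟶β= ((refl , _) ∷ rs) = cong (_ ∷_) (domain-⟶⟶β= rs)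

  ok-⟶⟶β= : ∀ {Γ Δ} → Γ ok → Γ ⟶⟶β= Δ → Δ ok
  ok-⟶⟶β= [] [] = []
  ok-⟶⟶β= (ext wf dA x∉) ((refl , A⟶) ∷ rs) =
    -- The declared type is moved to the reduced context before it is itself reduced.
    ext wf′ (subject-⇛ (⊢-⊑ dA wf′ (⟶⟶β=⇒⊑ rs)) (⟶β=⇒⇛ A⟶))
      (subst (_ ∉_) (domain-⟶⟶β= rs) x∉)
    where wf′ = ok-⟶⟶β= wf rs

theorem2 : ∀ {s a r : Level} (𝒱 : Variables) (𝒫 : PTS s a r) →
    let open Typing 𝒱 𝒫 in
    ((Γ Δ : Context) → Γ ok → Γ ⟶⟶β= Δ → Δ ok)
    × ((Γ Δ : Context) (M N A : Λ) →
    Γ ⊢ M ∶ A → Γ ⟶⟶β= Δ → M ⟶β= N → Δ ⊢ N ∶ A)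
theorem2 𝒱 𝒫 =
  (λ _ _ → ok-⟶⟶β=) ,
  (λ _ _ _ _ _ d rs M⟶N →
    subject-⇛ (⊢-⊑ d (ok-⟶⟶β= (⊢⇒ok d) rs) (⟶⟶β=⇒⊑ rs)) (⟶β=⇒⇛ M⟶N))
  where
  open ParallelReduction 𝒱 (PTS.Sort 𝒫)
  open TypingProperties 𝒱 𝒫
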